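{- Let $n=6k+3$ with $k\ge 6$, and let $P(n,3)$ be the generalized Petersen graph with vertex set $\{u_1,\dots,u_n,v_1,\dots,v_n\}$ and edge set $\{u_iu_{i+1},\,u_iv_i,\,v_iv_{i+3}:1\le i\le n\}$ (subscripts modulo $n$). Then $\dim(P(n,3))\ge 4$.
   Context: For a connected graph $G$, an ordered set $W=\{w_1,\dots,w_m\}\subseteq V(G)$ is a resolving set if the vectors $r(z|W)=(d(z,w_1),\dots,d(z,w_m))$ of shortest-path distances are pairwise distinct over all $z\in V(G)$. The metric dimension $\dim(G)$ is the minimum cardinality of a resolving set of $G$. -}

module Defs where

open import Data.Nat using (ℕ; zero; suc; _+_; _*_; _≤_; NonZero)
open import Data.Nat.DivMod using (_%_; m%n<n)
open import Data.Fin using (Fin; toℕ; fromℕ<)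
open import Data.Sum using (_⊎_; inj₁; inj₂)
open import Data.Product using (_×_)
open import Data.List using (List)
open import Data.List.Membership.Propositional using (_∈_)
open import Relation.Binary.PropositionalEquality using (_≡_)

_⊕_ : ∀ {n} .{{_ : NonZero n}} → Fin n → ℕ → Fin n
_⊕_ {n} i j = fromℕ< (m%n<n (toℕ i + j) n)

-- Vertices of P(n,3): inj₁ i = u_i, inj₂ i = v_i (indices 0..n-1, i.e. shifted by one)
PVertex : ℕ → Set
PVertex n = Fin n ⊎ Fin n

data PAdj (n : ℕ) .{{_ : NonZero n}} : PVertex n → PVertex n → Set where
  outer  : ∀ i → PAdj n (inj₁ i) (inj₁ (i ⊕ 1))
  outer' : ∀ i → PAdj n (inj₁ (i ⊕ 1)) (inj₁ i)
  spoke  : ∀ i → PAdj n (inj₁ i) (inj₂ i)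
  spoke' : ∀ i → PAdj n (inj₂ i) (inj₁ i)
  inner  : ∀ i → PAdj n (inj₂ i) (inj₂ (i ⊕ 3))
  inner' : ∀ i → PAdj n (inj₂ (i ⊕ 3)) (inj₂ i)

module _ {V : Set} (Adj : V → V → Set) where

  data Walk : V → V → ℕ → Set where
    here : ∀ {x} → Walk x x 0
    step : ∀ {x y z ℓ} → Adj x y → Walk y z ℓ → Walk x z (suc ℓ)

  IsDist : V → V → ℕ → Set
  IsDist x y d = Walk x y d × (∀ m → Walk x y m → d ≤ m)

  Resolving : List V → Set
  Resolving W = ∀ z z' →
    (∀ w → w ∈ W → ∀ d d' → IsDist z w d → IsDist z' w d' → d ≡ d') →
    z ≡ z'

{-# OPTIONS --safe #-}

-- Whether a landmark distinguishes two vertices of nearby index depends, away from the landmark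
-- and its antipode, only on its side, its layer and its residue modulo 3. Given three landmarks,
-- an undistinguished pair is found in a window of eleven indices around the first one or in a
-- window of eleven around its antipode. Passing from k to k + 1 inserts three indices on each
-- half of the cycle; seen from both windows, each landmark of P(6k+9,3) looks like some landmark
-- of P(6k+3,3), up to an additive constant on each window. By induction everything reduces to
-- k = 6, a finite check.
module Submission where

open import Defs
open import Data.Nat using (ℕ; zero; suc; _+_; _*_; _∸_; _⊓_; _≤_; _<_; z≤n; s≤s; NonZero; _≟_; _≤?_)
open import Data.Nat.Properties
open import Data.Nat.DivMod using (_%_; m%n<n; m%n%n≡m%n; m<n⇒m%n≡m; n%n≡0; [m+n]%n≡m%n; [m+kn]%n≡m%n; %-distribˡ-+)
open import Data.Nat.Tactic.RingSolver using (solve-∀)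
open import Data.Fin using (Fin; zero; toℕ)
open import Data.Fin.Properties using (toℕ-fromℕ<; toℕ-injective; toℕ<n)
open import Data.List using (List; []; _∷_; length)
open import Data.List.Membership.Propositional using (find)
open import Data.List.Relation.Binary.Subset.Propositional using (_⊆_)
open import Data.List.Relation.Unary.All as All using (All; []; _∷_)
open import Data.List.Relation.Unary.Any as Any using (Any; any?)
open import Data.List.Relation.Unary.Unique.Propositional using (Unique)
open import Data.Product using (∃; _×_; _,_; proj₁; proj₂)
open import Data.Product.Properties using (≡-dec)
open import Data.Sum using (inj₁; inj₂)
open import Relation.Nullary using (¬_; Dec; yes; no; contradiction)
open import Relation.Nullary.Decidable using (from-yes; map′; ¬?; _×-dec_)
open import Relation.Binary.PropositionalEquality

-- Arithmetic of cyclic indices.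

module _ {n : ℕ} .{{_ : NonZero n}} where

  %-absorbˡ : ∀ x y → (x % n + y) % n ≡ (x + y) % n
  %-absorbˡ x y = begin
    (x % n + y) % n         ≡⟨ %-distribˡ-+ (x % n) y n ⟩
    (x % n % n + y % n) % n ≡⟨ cong (λ r → (r + y % n) % n) (m%n%n≡m%n x n) ⟩
    (x % n + y % n) % n     ≡⟨ %-distribˡ-+ x y n ⟨
    (x + y) % n             ∎
    where open ≡-Reasoning

  %-cancelˡ : ∀ x {y z} → y < n → z < n → (x + y) % n ≡ (x + z) % n → y ≡ z
  %-cancelˡ x {y} {z} y<n z<n eq = trans (sym (undo y<n)) (trans (cong (λ r → (r + c) % n) eq) (undo z<n))
    where
    open ≡-Reasoning
    -- Acts as -`x` modulo `n`; the multiple `x * n` is taken because `x` may exceed `n`.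
    c = x * n ∸ x
    regroup : ∀ v → x + v + c ≡ v + x * n
    regroup v = begin
      x + v + c     ≡⟨ cong (_+ c) (+-comm x v) ⟩
      v + x + c     ≡⟨ +-assoc v x c ⟩
      v + (x + c)   ≡⟨ cong (v +_) (m+[n∸m]≡n (m≤m*n x n)) ⟩
      v + x * n     ∎
    undo : ∀ {v} → v < n → ((x + v) % n + c) % n ≡ v
    undo {v} v<n = begin
      ((x + v) % n + c) % n ≡⟨ %-absorbˡ (x + v) c ⟩
      (x + v + c) % n       ≡⟨ cong (_% n) (regroup v) ⟩
      (v + x * n) % n       ≡⟨ [m+kn]%n≡m%n v x n ⟩
      v % n                 ≡⟨ m<n⇒m%n≡m v<n ⟩
      v                     ∎

  toℕ-⊕ : (i : Fin n) (s : ℕ) → toℕ (i ⊕ s) ≡ (toℕ i + s) % n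
  toℕ-⊕ i s = toℕ-fromℕ< (m%n<n (toℕ i + s) n)

  ⊕-cancelˡ : (i : Fin n) {s s' : ℕ} → s < n → s' < n → i ⊕ s ≡ i ⊕ s' → s ≡ s'
  ⊕-cancelˡ i {s} {s'} s<n s'<n eq =
    %-cancelˡ (toℕ i) s<n s'<n (trans (sym (toℕ-⊕ i s)) (trans (cong toℕ eq) (toℕ-⊕ i s')))

  ⊕-assoc : (i : Fin n) (s s' : ℕ) → (i ⊕ s) ⊕ s' ≡ i ⊕ (s + s')
  ⊕-assoc i s s' = toℕ-injective (begin
    toℕ ((i ⊕ s) ⊕ s')          ≡⟨ toℕ-⊕ (i ⊕ s) s' ⟩
    (toℕ (i ⊕ s) + s') % n      ≡⟨ cong (λ r → (r + s') % n) (toℕ-⊕ i s) ⟩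
    ((toℕ i + s) % n + s') % n  ≡⟨ %-absorbˡ (toℕ i + s) s' ⟩
    (toℕ i + s + s') % n        ≡⟨ cong (_% n) (+-assoc (toℕ i) s s') ⟩
    (toℕ i + (s + s')) % n      ≡⟨ toℕ-⊕ i (s + s') ⟨
    toℕ (i ⊕ (s + s'))          ∎)
    where open ≡-Reasoning

  ⊕-full : (i : Fin n) → i ⊕ n ≡ i
  ⊕-full i = toℕ-injective (trans (toℕ-⊕ i n) (trans ([m+n]%n≡m%n (toℕ i) n) (m<n⇒m%n≡m (toℕ<n i))))

  ⊕-back : (i : Fin n) {s : ℕ} → s ≤ n → (i ⊕ (n ∸ s)) ⊕ s ≡ i
  ⊕-back i {s} s≤n = trans (⊕-assoc i (n ∸ s) s) (trans (cong (i ⊕_) (m∸n+n≡m s≤n)) (⊕-full i))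

-- Distances in the infinite analogue.

data Layer : Set where
  rim hub : Layer

flip : Layer → Layer
flip rim = hub
flip hub = rim

_≟ᴸ_ : (a b : Layer) → Dec (a ≡ b)
rim ≟ᴸ rim = yes refl
rim ≟ᴸ hub = no λ ()
hub ≟ᴸ rim = no λ ()
hub ≟ᴸ hub = yes refl

-- ray t a x is the distance from the index-0 vertex of layer t to the index-x vertex of
-- layer a in the two-way infinite analogue of P(n,3).
ray : Layer → Layer → ℕ → ℕ
ray rim rim (suc (suc (suc x))) = 2 + ray rim hub x
ray rim rim x = x
ray hub hub 0 = 0
ray hub hub 1 = 3
ray hub hub 2 = 4
ray hub hub (suc (suc (suc x))) = suc (ray hub hub x)
ray rim hub 0 = 1
ray rim hub 1 = 2
ray rim hub 2 = 3
ray rim hub (suc (suc (suc x))) = suc (ray rim hub x)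
ray hub rim 0 = 1
ray hub rim 1 = 2
ray hub rim 2 = 3
ray hub rim (suc (suc (suc x))) = suc (ray hub rim x)

-- Far out, three more indices cost one more inner edge. Rim to rim forces the offset 3: below index
-- 3 the shortest route stays on the rim, and the first three indices added there cost 3.
ray-shift : ∀ t a x → ray t a (6 + x) ≡ suc (ray t a (3 + x))
ray-shift rim rim x = refl
ray-shift rim hub x = refl
ray-shift hub rim x = refl
ray-shift hub hub x = refl

ray-hub-shift : ∀ t x → ray t hub (3 + x) ≡ suc (ray t hub x)
ray-hub-shift rim x = refl
ray-hub-shift hub x = refl

Close : ℕ → ℕ → Set
Close x y = x ≤ suc y × y ≤ suc x

close-sym : ∀ {x y} → Close x y → Close y x
close-sym (p , q) = q , p

close-refl : ∀ {x y} → x ≡ y → Close x y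
close-refl refl = n≤1+n _ , n≤1+n _

close-suc : ∀ {x y} → y ≡ suc x → Close x y
close-suc refl = m≤n⇒m≤1+n (n≤1+n _) , ≤-refl

close-+ : ∀ c {x y} → Close x y → Close (c + x) (c + y)
close-+ zero p = p
close-+ (suc c) p = s≤s (proj₁ (close-+ c p)) , s≤s (proj₂ (close-+ c p))

close-subst : ∀ {x y x' y'} → x ≡ x' → y ≡ y' → Close x' y' → Close x y
close-subst refl refl p = p

ray-spoke : ∀ t x → Close (ray t rim x) (ray t hub x)
ray-spoke rim 0 = close-suc refl
ray-spoke rim 1 = close-suc refl
ray-spoke rim 2 = close-suc refl
ray-spoke rim (suc (suc (suc x))) = close-sym (close-suc refl)
ray-spoke hub 0 = close-sym (close-suc refl)
ray-spoke hub 1 = close-suc refl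
ray-spoke hub 2 = close-suc refl
ray-spoke hub (suc (suc (suc x))) = close-+ 1 (ray-spoke hub x)

-- Between hub vertices this fails, as `ray hub hub` jumps from 0 to 3 at the first index; rim to
-- rim is left to `ray-rim-step`, which from index 3 on reduces to rim to hub.
ray-step : ∀ t a → a ≢ t → ∀ x → Close (ray t a x) (ray t a (suc x))
ray-step rim rim a≢t x = contradiction refl a≢t
ray-step hub hub a≢t x = contradiction refl a≢t
ray-step rim hub _ 0 = close-suc refl
ray-step rim hub _ 1 = close-suc refl
ray-step rim hub _ 2 = close-sym (close-suc refl)
ray-step rim hub p (suc (suc (suc x))) = close-+ 1 (ray-step rim hub p x)
ray-step hub rim _ 0 = close-suc refl
ray-step hub rim _ 1 = close-suc refl
ray-step hub rim _ 2 = close-sym (close-suc refl)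
ray-step hub rim p (suc (suc (suc x))) = close-+ 1 (ray-step hub rim p x)

ray-rim-step : ∀ t x → Close (ray t rim x) (ray t rim (suc x))
ray-rim-step hub x = ray-step hub rim (λ ()) x
ray-rim-step rim 0 = close-suc refl
ray-rim-step rim 1 = close-suc refl
ray-rim-step rim 2 = close-suc refl
ray-rim-step rim (suc (suc (suc x))) = close-+ 2 (ray-step rim hub (λ ()) x)

ray-hub-far : ∀ t q r → ray t hub (3 * q + r) ≡ q + ray t hub r
ray-hub-far t zero r = refl
ray-hub-far t (suc q) r = begin
  ray t hub (3 * suc q + r)   ≡⟨ cong (ray t hub) (regroup q r) ⟩
  ray t hub (3 + (3 * q + r)) ≡⟨ ray-hub-shift t (3 * q + r) ⟩
  suc (ray t hub (3 * q + r)) ≡⟨ cong suc (ray-hub-far t q r) ⟩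
  suc (q + ray t hub r)       ∎
  where
  open ≡-Reasoning
  regroup : ∀ q r → 3 * suc q + r ≡ 3 + (3 * q + r)
  regroup = solve-∀

-- Some neighbour one step closer always has an index that is not larger.
data Descent (t : Layer) : Layer → ℕ → ℕ → Set where
  cross : ∀ {a x d} → ray t (flip a) x ≡ d → Descent t a x d
  along-rim : ∀ {x d} → ray t rim x ≡ d → Descent t rim (suc x) d
  along-hub : ∀ {x d} → ray t hub x ≡ d → Descent t hub (3 + x) d

descent : ∀ t a x {d} → ray t a x ≡ suc d → Descent t a x d
descent rim rim 1 refl = along-rim refl
descent rim rim 2 refl = along-rim refl
descent rim rim (suc (suc (suc x))) refl = cross refl
descent rim hub 0 refl = cross refl
descent rim hub 1 refl = cross refl
descent rim hub 2 refl = cross refl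
descent rim hub (suc (suc (suc x))) refl = along-hub refl
descent hub hub 1 refl = cross refl
descent hub hub 2 refl = cross refl
descent hub hub (suc (suc (suc x))) refl = along-hub refl
descent hub rim 0 refl = cross refl
descent hub rim 1 refl = along-rim refl
descent hub rim 2 refl = along-rim refl
-- Both layers gain one per three indices here, so the step found three indices earlier carries
-- over. The `{zero}` clauses are void: `ray hub rim` is at least 2 from index 1 on.
descent hub rim (suc (suc (suc x))) {suc d} eq with descent hub rim x (suc-injective eq)
... | cross p = cross (cong suc p)
... | along-rim p = along-rim (cong suc p)
descent hub rim (suc (suc (suc zero))) {zero} ()
descent hub rim (suc (suc (suc (suc zero)))) {zero} ()
descent hub rim (suc (suc (suc (suc (suc zero))))) {zero} ()
descent hub rim (suc (suc (suc (suc (suc (suc x)))))) {zero} ()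

ray-source : ∀ t → ray t t 0 ≡ 0
ray-source rim = refl
ray-source hub = refl

ray-zero : ∀ t a x → ray t a x ≡ 0 → t ≡ a × x ≡ 0
ray-zero rim rim 0 _ = refl , refl
ray-zero hub hub 0 _ = refl , refl
ray-zero rim rim 1 ()
ray-zero rim rim 2 ()
ray-zero rim rim (suc (suc (suc x))) ()
ray-zero hub hub 1 ()
ray-zero hub hub 2 ()
ray-zero rim hub 1 ()
ray-zero rim hub 2 ()
ray-zero hub rim 1 ()
ray-zero hub rim 2 ()

-- Distances on the cycle and the base case.

order : ℕ → ℕ
order k = 3 + 6 * k

-- The closed form for distances in P(6k+3,3), using the shorter arc only. That this is optimal
-- needs proof, since `ray` is not monotone (`ray rim hub 2` exceeds `ray rim hub 3`);
-- `isDist⇒distTo` supplies it for every positive `k`.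
dist : ℕ → Layer → Layer → ℕ → ℕ
dist k t a j = ray t a (r ⊓ (order k ∸ r))
  where r = j % order k

-- The windows start four indices before the first landmark and 3k indices further on.
data Window : Set where
  near anti : Window

start : Window → ℕ → ℕ
start near k = 0
start anti k = 3 * k

Spot : Set
Spot = Layer × ℕ

Pair : Set
Pair = Window × Spot × Spot

Valid : Pair → Set
Valid (_ , s , s') = proj₂ s ≤ 10 × proj₂ s' ≤ 10 × s ≢ s'

-- δ is the index of the start of the near window relative to the landmark.
Blind : ℕ → Pair → Layer → ℕ → Set
Blind k (w , (a , m) , (a' , m')) t δ =
  dist k t a (start w k + δ + m) ≡ dist k t a' (start w k + δ + m')

blind? : ∀ k p t δ → Dec (Blind k p t δ)
blind? k (w , (a , m) , (a' , m')) t δ = _ ≟ _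

valid? : ∀ p → Dec (Valid p)
valid? (_ , s , s') = (proj₂ s ≤? 10) ×-dec (proj₂ s' ≤? 10) ×-dec ¬? (≡-dec _≟ᴸ_ _≟_ s s')

allLayers? : ∀ {P : Layer → Set} → (∀ a → Dec (P a)) → Dec (∀ a → P a)
allLayers? P? = map′ (λ { (p , q) rim → p ; (p , q) hub → q }) (λ f → f rim , f hub) (P? rim ×-dec P? hub)

-- A covering family for the base case: any three landmarks of P(39,3), the first lying four indices
-- past the start of the near window, all fail on one of these pairs.
pairs : List Pair
pairs =
  (anti , (rim , 7) , (rim , 9)) ∷ (anti , (rim , 2) , (rim , 4)) ∷ (anti , (rim , 0) , (rim , 2)) ∷
  (anti , (hub , 6) , (hub , 8)) ∷ (near , (rim , 3) , (rim , 5)) ∷ (near , (rim , 8) , (rim , 10)) ∷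
  (anti , (rim , 3) , (rim , 5)) ∷ (near , (hub , 0) , (hub , 2)) ∷ (anti , (rim , 6) , (rim , 8)) ∷
  (near , (hub , 1) , (hub , 3)) ∷ (near , (rim , 1) , (rim , 3)) ∷ (anti , (rim , 0) , (hub , 3)) ∷
  (near , (rim , 5) , (rim , 7)) ∷ (near , (hub , 6) , (hub , 8)) ∷ (near , (rim , 0) , (rim , 10)) ∷
  (near , (hub , 0) , (hub , 6)) ∷ (near , (hub , 1) , (hub , 7)) ∷ (anti , (rim , 0) , (rim , 7)) ∷
  (anti , (rim , 2) , (rim , 9)) ∷ (near , (rim , 3) , (hub , 4)) ∷ (near , (rim , 1) , (hub , 0)) ∷
  (near , (rim , 1) , (hub , 2)) ∷ (near , (rim , 0) , (rim , 2)) ∷ (near , (rim , 1) , (hub , 10)) ∷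
  (near , (rim , 2) , (hub , 1)) ∷ (near , (rim , 2) , (hub , 3)) ∷ (near , (rim , 9) , (hub , 8)) ∷
  (near , (rim , 10) , (hub , 5)) ∷ []

-- abstract keeps the k = 6 computation from being unfolded later; 35 is −4 modulo 39.
abstract
  pairs-valid : All Valid pairs
  pairs-valid = from-yes (All.all? valid? pairs)

  pairs-suffice : ∀ t₁ t₂ t₃ {δ₂} → δ₂ < 39 → ∀ {δ₃} → δ₃ < 39 →
    Any (λ p → Blind 6 p t₁ 35 × Blind 6 p t₂ δ₂ × Blind 6 p t₃ δ₃) pairs
  pairs-suffice = from-yes (allLayers? λ t₁ → allLayers? λ t₂ → allLayers? λ t₃ →
    allUpTo? (λ δ₂ → allUpTo? (λ δ₃ →
      any? (λ p → blind? 6 p t₁ 35 ×-dec blind? 6 p t₂ δ₂ ×-dec blind? 6 p t₃ δ₃) pairs) 39) 39)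

-- Growth of the closed form from `k` to `k + 1`.

order-halves : ∀ k → (1 + 3 * k) + (2 + 3 * k) ≡ order k
order-halves = halves
  where
  halves : ∀ k → (1 + 3 * k) + (2 + 3 * k) ≡ 3 + 6 * k
  halves = solve-∀

order-suc : ∀ k → order (suc k) ≡ 6 + order k
order-suc = expand
  where
  expand : ∀ k → 3 + 6 * suc k ≡ 6 + (3 + 6 * k)
  expand = solve-∀

dist-mod : ∀ k t a {j j'} → j % order k ≡ j' % order k → dist k t a j ≡ dist k t a j'
dist-mod k t a = cong (λ r → ray t a (r ⊓ (order k ∸ r)))

dist-period : ∀ k t a j → dist k t a (j + order k) ≡ dist k t a j
dist-period k t a j = dist-mod k t a {j + order k} {j} ([m+n]%n≡m%n j (order k))

dist-near : ∀ k t a {x} → x ≤ 1 + 3 * k → dist k t a x ≡ ray t a x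
dist-near k t a {x} x≤ = cong (ray t a) (begin
  x % n ⊓ (n ∸ x % n) ≡⟨ cong (λ r → r ⊓ (n ∸ r)) (m<n⇒m%n≡m x<n) ⟩
  x ⊓ (n ∸ x)         ≡⟨ m≤n⇒m⊓n≡m (m+n≤o⇒m≤o∸n x (<⇒≤ x+x<n)) ⟩
  x                   ∎)
  where
  open ≡-Reasoning
  n = order k
  x+x<n : x + x < n
  x+x<n = subst (suc (x + x) ≤_) (order-halves k)
    (subst (_≤ (1 + 3 * k) + (2 + 3 * k)) (+-suc x x) (+-mono-≤ x≤ (s≤s x≤)))
  x<n : x < n
  x<n = ≤-<-trans (m≤m+n x x) x+x<n

dist-far : ∀ k t a {x y} → x + y ≡ order k → y ≤ 1 + 3 * k → dist k t a x ≡ ray t a y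
dist-far k t a {x} {zero} eq _ =
  cong (λ r → ray t a (r ⊓ (order k ∸ r)))
    (trans (cong (_% order k) (trans (sym (+-identityʳ x)) eq)) (n%n≡0 (order k)))
dist-far k t a {x} {y@(suc _)} eq y≤ = cong (ray t a) (begin
  x % n ⊓ (n ∸ x % n) ≡⟨ cong (λ r → r ⊓ (n ∸ r)) (m<n⇒m%n≡m x<n) ⟩
  x ⊓ (n ∸ x)         ≡⟨ cong (x ⊓_) n∸x≡y ⟩
  x ⊓ y               ≡⟨ m≥n⇒m⊓n≡n y≤x ⟩
  y                   ∎)
  where
  open ≡-Reasoning
  n = order k
  x<n : x < n
  x<n = subst (x <_) eq (m<m+n x (s≤s z≤n))
  n∸x≡y : n ∸ x ≡ y
  n∸x≡y = trans (cong (_∸ x) (sym eq)) (m+n∸m≡n x y)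
  y≤x : y ≤ x
  y≤x = ≤-trans y≤ (≤-trans (n≤1+n _) (+-cancelʳ-≤ y (2 + 3 * k) x
    (≤-trans (+-monoʳ-≤ (2 + 3 * k) y≤)
      (≤-reflexive (trans (+-comm (2 + 3 * k) (1 + 3 * k)) (trans (order-halves k) (sym eq)))))))

far-side : ∀ k {x} → x ≤ order k → 2 + 3 * k ≤ x → ∃ λ y → x + y ≡ order k × y ≤ 1 + 3 * k
far-side k {x} x≤ lo = order k ∸ x , m+[n∸m]≡n x≤ ,
  ≤-trans (∸-monoʳ-≤ (order k) lo)
    (≤-reflexive (trans (cong (_∸ (2 + 3 * k)) (sym (order-halves k))) (m+n∸n≡m (1 + 3 * k) (2 + 3 * k))))

-- The order is odd, so the two arcs never tie: the shorter is at most `1 + 3 * k`, the longer at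
-- least `2 + 3 * k`.
data Side (k x : ℕ) : Set where
  on-near : x ≤ 1 + 3 * k → Side k x
  on-far : ∀ {y} → x + y ≡ order k → y ≤ 1 + 3 * k → Side k x

side : ∀ k {x} → x ≤ order k → Side k x
side k {x} x≤ with x ≤? 1 + 3 * k
... | yes p = on-near p
... | no ¬p with far-side k x≤ (≰⇒> ¬p)
...   | y , eq , y≤ = on-far eq y≤

grow-half : ∀ k → 3 + (1 + 3 * k) ≡ 1 + 3 * suc k
grow-half = solve-∀

half-mono : ∀ k {x} → x ≤ 1 + 3 * k → 3 + x ≤ 1 + 3 * suc k
half-mono k x≤ = ≤-trans (+-monoʳ-≤ 3 x≤) (≤-reflexive (grow-half k))

half-mono₀ : ∀ k {x} → x ≤ 1 + 3 * k → x ≤ 1 + 3 * suc k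
half-mono₀ k x≤ = ≤-trans (m≤n+m _ 3) (half-mono k x≤)

-- All six new indices fall on the longer arc.
dist-grow₁ : ∀ k t a {j} → j ≤ 1 + 3 * k → dist (suc k) t a j ≡ dist k t a j
dist-grow₁ k t a j≤ = trans (dist-near (suc k) t a (half-mono₀ k j≤)) (sym (dist-near k t a j≤))

-- Three new indices fall on each arc, so the shorter one grows by 3. The two bounds keep both arcs
-- at least 3 long, as `ray-shift` requires.
dist-grow₂ : ∀ k t a {j} → 3 ≤ j → 3 + j ≤ order k → dist (suc k) t a (3 + j) ≡ suc (dist k t a j)
dist-grow₂ k t a {suc (suc (suc j))} (s≤s (s≤s (s≤s _))) hi with side k (≤-trans (m≤n+m _ 3) hi)
... | on-near p =
  trans (dist-near (suc k) t a (half-mono k p)) (trans (ray-shift t a j) (cong suc (sym (dist-near k t a p))))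
... | on-far {y} eq y≤ with m≤n⇒∃[o]m+o≡n 3≤y
  where
  3≤y : 3 ≤ y
  3≤y = +-cancelʳ-≤ (3 + j) 3 y (≤-trans hi (≤-reflexive (trans (sym eq) (+-comm (3 + j) y))))
...   | y′ , refl = trans (dist-far (suc k) t a {6 + j} eq′ (half-mono k y≤))
        (trans (ray-shift t a y′) (cong suc (sym (dist-far k t a {3 + j} eq y≤))))
  where
  regroup : ∀ x y → (6 + x) + (6 + y) ≡ 6 + ((3 + x) + (3 + y))
  regroup = solve-∀
  eq′ : (6 + j) + (6 + y′) ≡ order (suc k)
  eq′ = trans (regroup j y′) (trans (cong (6 +_) eq) (sym (order-suc k)))

+-order-suc : ∀ k x → 6 + (x + order k) ≡ x + order (suc k)
+-order-suc k x = trans (swap x (order k)) (cong (x +_) (sym (order-suc k)))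
  where
  swap : ∀ x n → 6 + (x + n) ≡ x + (6 + n)
  swap = solve-∀

-- The new indices all lie behind `j`, while the arc that counts runs on from `j` to the end of the
-- lap. Past `order k` a new lap begins, where `dist-grow₁` applies.
dist-grow₃ : ∀ k t a {j} → 2 + 3 * k ≤ j → j ≤ order k + (1 + 3 * k) → dist (suc k) t a (6 + j) ≡ dist k t a j
dist-grow₃ k t a {j} lo hi with j ≤? order k
... | yes p with far-side k p lo
...   | y , eq , y≤ = trans (dist-far (suc k) t a (trans (cong (6 +_) eq) (sym (order-suc k))) (half-mono₀ k y≤))
                        (sym (dist-far k t a eq y≤))
dist-grow₃ k t a {j} lo hi | no ¬p with m≤n⇒∃[o]m+o≡n (<⇒≤ (≰⇒> ¬p))
... | x , refl = begin
  dist (suc k) t a (6 + (order k + x))   ≡⟨ cong (dist (suc k) t a) (trans (cong (6 +_) (+-comm (order k) x)) (+-order-suc k x)) ⟩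
  dist (suc k) t a (x + order (suc k))   ≡⟨ dist-period (suc k) t a x ⟩
  dist (suc k) t a x                     ≡⟨ dist-grow₁ k t a (+-cancelˡ-≤ (order k) x _ hi) ⟩
  dist k t a x                           ≡⟨ dist-period k t a x ⟨
  dist k t a (x + order k)               ≡⟨ cong (dist k t a) (+-comm x (order k)) ⟩
  dist k t a (order k + x)               ∎
  where open ≡-Reasoning

dist-grow₄ : ∀ k t a {x} → 3 ≤ x → 3 + x ≤ order k → dist (suc k) t a (9 + (x + order k)) ≡ suc (dist k t a (x + order k))
dist-grow₄ k t a {x} lo hi = begin
  dist (suc k) t a (9 + (x + order k))     ≡⟨ cong (dist (suc k) t a) (cong (3 +_) (+-order-suc k x)) ⟩
  dist (suc k) t a (3 + x + order (suc k)) ≡⟨ dist-period (suc k) t a (3 + x) ⟩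
  dist (suc k) t a (3 + x)                 ≡⟨ dist-grow₂ k t a lo hi ⟩
  suc (dist k t a x)                       ≡⟨ cong suc (dist-period k t a x) ⟨
  suc (dist k t a (x + order k))           ∎
  where open ≡-Reasoning

-- Transport of landmarks between `k + 1` and `k`.

order-double : ∀ k → order k ≡ 3 + (3 * k + 3 * k)
order-double = expand
  where
  expand : ∀ k → 3 + 6 * k ≡ 3 + (3 * k + 3 * k)
  expand = solve-∀

-- The constant `e` may vary with the window but not with the layer or index seen, so equal
-- distances within one window stay equal. This is why a `Pair` lies in a single window.
Lifts : ℕ → ℕ → ℕ → Set
Lifts k δ δ' = ∀ w → ∃ λ e → ∀ t a {m} → m ≤ 10 →
  dist (suc k) t a (start w (suc k) + δ' + m) ≡ e + dist k t a (start w k + δ + m)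

module _ {k : ℕ} (6≤k : 6 ≤ k) where

  private
    -- Gives half the cycle room for a window plus margins. The tightest use is the near window in
    -- `lifts-middle`, which can reach index `18 + 3 * k` from the landmark.
    18≤3k : 18 ≤ 3 * k
    18≤3k = *-monoʳ-≤ 3 6≤k

    below-order : ∀ {x} c → c ≤ 18 → x ≤ c + 3 * k → 3 + x ≤ order k
    below-order {x} c c≤ x≤ = begin
      3 + x               ≤⟨ +-monoʳ-≤ 3 x≤ ⟩
      3 + (c + 3 * k)     ≤⟨ +-monoʳ-≤ 3 (+-monoˡ-≤ (3 * k) (≤-trans c≤ 18≤3k)) ⟩
      3 + (3 * k + 3 * k) ≡⟨ order-double k ⟨
      order k             ∎
      where open ≤-Reasoning

    below-order+half : ∀ {x} c d → c + d ≤ 19 → x ≤ c + (d + (3 * k + 3 * k)) → x ≤ order k + (1 + 3 * k)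
    below-order+half {x} c d c+d≤ x≤ = begin
      x                                ≤⟨ x≤ ⟩
      c + (d + (3 * k + 3 * k))        ≡⟨ +-assoc c d _ ⟨
      c + d + (3 * k + 3 * k)          ≤⟨ +-monoˡ-≤ _ (≤-trans c+d≤ (s≤s 18≤3k)) ⟩
      1 + 3 * k + (3 * k + 3 * k)      ≤⟨ m≤n+m _ 3 ⟩
      3 + (1 + 3 * k + (3 * k + 3 * k)) ≡⟨ regroup (3 * k) ⟩
      3 + (3 * k + 3 * k) + (1 + 3 * k) ≡⟨ cong (_+ (1 + 3 * k)) (order-double k) ⟨
      order k + (1 + 3 * k)            ∎
      where
      open ≤-Reasoning
      regroup : ∀ h → 3 + (1 + h + (h + h)) ≡ 3 + (h + h) + (1 + h)
      regroup = solve-∀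

  -- The landmark sits at most five indices before the near window and keeps its place relative to
  -- it; the anti window recedes by 3 both ways round.
  lifts-early : ∀ {δ} → δ ≤ 5 → Lifts k δ δ
  lifts-early {δ} δ≤ near = 0 , λ t a {m} m≤ →
    dist-grow₁ k t a (≤-trans (+-mono-≤ δ≤ m≤) (≤-trans (m≤m+n 15 4) (s≤s 18≤3k)))
  lifts-early {δ} δ≤ anti = 1 , λ t a {m} m≤ →
    trans (cong (dist (suc k) t a) (shift k δ m))
      (dist-grow₂ k t a {3 * k + δ + m}
        (≤-trans (m≤m+n 3 15) (≤-trans 18≤3k (≤-trans (m≤m+n (3 * k) δ) (m≤m+n (3 * k + δ) m))))
        (below-order 15 (m≤m+n 15 3) (≤-trans (≤-reflexive (front (3 * k) δ m)) (+-monoˡ-≤ (3 * k) (+-mono-≤ δ≤ m≤)))))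
    where
    shift : ∀ k δ m → 3 * suc k + δ + m ≡ 3 + (3 * k + δ + m)
    shift = solve-∀
    front : ∀ h δ m → h + δ + m ≡ δ + m + h
    front = solve-∀

  -- The landmark lies between shortly before the anti window and shortly before the near one. It
  -- moves along with the anti window, hence `3 + δ`, and the near window recedes.
  lifts-middle : ∀ {δ} → 3 ≤ δ → δ ≤ 8 + 3 * k → Lifts k δ (3 + δ)
  lifts-middle {δ} lo hi near = 1 , λ t a {m} m≤ →
    dist-grow₂ k t a (≤-trans lo (m≤m+n δ m))
      (below-order 18 ≤-refl (≤-trans (+-mono-≤ hi m≤) (≤-reflexive (front (3 * k)))))
    where
    front : ∀ h → 8 + h + 10 ≡ 18 + h
    front = solve-∀
  lifts-middle {δ} lo hi anti = 0 , λ t a {m} m≤ →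
    trans (cong (dist (suc k) t a) (shift k δ m))
      (dist-grow₃ k t a {3 * k + δ + m}
        (≤-trans (≤-trans (≤-reflexive (+-comm 2 (3 * k))) (+-monoʳ-≤ (3 * k) (≤-trans (n≤1+n 2) lo))) (m≤m+n _ m))
        (below-order+half 10 8 (n≤1+n 18)
          (≤-trans (+-mono-≤ (+-monoʳ-≤ (3 * k) hi) m≤) (≤-reflexive (front (3 * k))))))
    where
    shift : ∀ k δ m → 3 * suc k + (3 + δ) + m ≡ 6 + (3 * k + δ + m)
    shift = solve-∀
    front : ∀ h → h + (8 + h) + 10 ≡ 10 + (8 + (h + h))
    front = solve-∀

  -- The landmark lies between the starts of the windows and stays put relative to the near one, so
  -- `δ`, measured forward around the cycle, grows with the order. The bound `6 + 3 * k` starts the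
  -- anti window at least 3 indices past the landmark.
  lifts-late : ∀ {δ} → 6 + 3 * k ≤ δ → δ < order k → Lifts k δ (6 + δ)
  lifts-late {δ} lo hi near = 0 , λ t a {m} m≤ →
    dist-grow₃ k t a (≤-trans (m≤n+m _ 4) (≤-trans lo (m≤m+n δ m)))
      (below-order+half 10 3 (m≤m+n 13 6)
        (≤-trans (+-mono-≤ (≤-trans (<⇒≤ hi) (≤-reflexive (order-double k))) m≤) (≤-reflexive (+-comm (3 + (3 * k + 3 * k)) 10))))
  lifts-late {δ} lo hi anti with m≤n⇒∃[o]m+o≡n lo
  ... | d , refl = 1 , λ t a {m} m≤ → begin
    dist (suc k) t a (3 * suc k + (6 + (6 + 3 * k + d)) + m) ≡⟨ cong (dist (suc k) t a) (big k d m) ⟩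
    dist (suc k) t a (9 + (3 + d + m + order k))             ≡⟨ dist-grow₄ k t a {3 + d + m} (s≤s (s≤s (s≤s z≤n))) (below-order 10 (m≤m+n 10 8) (fits m≤)) ⟩
    suc (dist k t a (3 + d + m + order k))                   ≡⟨ cong (λ j → suc (dist k t a j)) (small k d m) ⟨
    suc (dist k t a (3 * k + (6 + 3 * k + d) + m))           ∎
    where
    open ≡-Reasoning
    big : ∀ k d m → 3 * suc k + (6 + (6 + 3 * k + d)) + m ≡ 9 + (3 + d + m + (3 + 6 * k))
    big = solve-∀
    small : ∀ k d m → 3 * k + (6 + 3 * k + d) + m ≡ 3 + d + m + (3 + 6 * k)
    small = solve-∀
    swap : ∀ h d → 3 + h + (3 + d) ≡ 6 + h + d
    swap = solve-∀
    3+d≤ : 3 + d ≤ 3 * k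
    3+d≤ = +-cancelˡ-≤ (3 + 3 * k) (3 + d) (3 * k)
      (≤-trans (≤-reflexive (swap (3 * k) d)) (≤-trans (<⇒≤ hi) (≤-reflexive (order-double k))))
    fits : ∀ {m} → m ≤ 10 → 3 + d + m ≤ 10 + 3 * k
    fits {m} m≤ = ≤-trans (+-mono-≤ 3+d≤ m≤) (≤-reflexive (+-comm (3 * k) 10))

  -- The images of the early, middle and late ranges are the offsets up to 5, from 6 to
  -- `11 + 3 * k`, and from `12 + 3 * k` on: together, all of them.
  shrink : ∀ {δ'} → δ' < order (suc k) → ∃ λ δ → δ < order k × Lifts k δ δ'
  shrink {δ'} δ'< with 6 ≤? δ' | 12 + 3 * k ≤? δ'
  ... | no ¬6≤ | _ = δ' , ≤-trans (≰⇒> ¬6≤) (≤-trans (m≤m+n 6 15) (below-order 18 ≤-refl (m≤m+n 18 (3 * k)))) , lifts-early (≤-pred (≰⇒> ¬6≤))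
  ... | yes 6≤ | no ¬12≤ with m≤n⇒∃[o]m+o≡n (≤-trans (m≤m+n 3 3) 6≤)
  ...   | δ , refl = δ , ≤-trans (m≤n+m _ 2) (below-order 8 (m≤m+n 8 10) δ≤) , lifts-middle (+-cancelˡ-≤ 3 3 δ 6≤) δ≤
    where
    δ≤ : δ ≤ 8 + 3 * k
    δ≤ = +-cancelˡ-≤ 3 δ (8 + 3 * k) (≤-pred (≰⇒> ¬12≤))
  shrink {δ'} δ'< | yes 6≤ | yes 12≤ with m≤n⇒∃[o]m+o≡n 6≤
  ...   | δ , refl = δ , δ< , lifts-late (+-cancelˡ-≤ 6 (6 + 3 * k) δ 12≤) δ<
    where
    δ< : δ < order k
    δ< = +-cancelˡ-≤ 6 (suc δ) (order k) (≤-trans δ'< (≤-reflexive (order-suc k)))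

blind-lift : ∀ {k δ δ'} → Lifts k δ δ' → ∀ p t → Valid p → Blind k p t δ → Blind (suc k) p t δ'
blind-lift L (w , (a , m) , (a' , m')) t (m≤ , m'≤ , _) eq with L w
... | e , f = trans (f t a m≤) (trans (cong (e +_) eq) (sym (f t a' m'≤)))

-- The pair found for the shrunken landmarks serves unchanged. The offset `35 + 6 * e` is -4 modulo
-- the order; it is always late, so the first landmark keeps this normal form throughout the
-- induction.
blind-pair : ∀ e t₁ t₂ t₃ {δ₂ δ₃} → δ₂ < order (6 + e) → δ₃ < order (6 + e) →
  ∃ λ p → Valid p × Blind (6 + e) p t₁ (35 + 6 * e) × Blind (6 + e) p t₂ δ₂ × Blind (6 + e) p t₃ δ₃
blind-pair zero t₁ t₂ t₃ δ₂< δ₃< with find (pairs-suffice t₁ t₂ t₃ δ₂< δ₃<)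
... | p , p∈ , blind = p , All.lookup pairs-valid p∈ , blind
blind-pair (suc e) t₁ t₂ t₃ {δ₂} {δ₃} δ₂< δ₃<
  with shrink (m≤m+n 6 e) δ₂< | shrink (m≤m+n 6 e) δ₃<
... | ε₂ , ε₂< , L₂ | ε₃ , ε₃< , L₃ with blind-pair e t₁ t₂ t₃ ε₂< ε₃<
... | p , v , b₁ , b₂ , b₃ =
  p , v , subst (Blind (7 + e) p t₁) (next e) (blind-lift L₁ p t₁ v b₁) , blind-lift L₂ p t₂ v b₂ , blind-lift L₃ p t₃ v b₃
  where
  next : ∀ e → 6 + (35 + 6 * e) ≡ 35 + 6 * suc e
  next = solve-∀
  past-half : ∀ e → 6 + 3 * (6 + e) + (11 + 3 * e) ≡ 35 + 6 * e
  past-half = solve-∀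
  before-end : ∀ e → 35 + 6 * e + 4 ≡ 3 + 6 * (6 + e)
  before-end = solve-∀
  L₁ : Lifts (6 + e) (35 + 6 * e) (6 + (35 + 6 * e))
  L₁ = lifts-late (m≤m+n 6 e)
    (≤-trans (m≤m+n _ (11 + 3 * e)) (≤-reflexive (past-half e)))
    (≤-trans (m<m+n (35 + 6 * e) (s≤s z≤n)) (≤-reflexive (before-end e)))

-- The closed form along edges.

dist-spoke : ∀ k t j → Close (dist k t rim j) (dist k t hub j)
dist-spoke k t j = ray-spoke t _

far-positive : ∀ {k j} → j < order k → j + 0 ≢ order k
far-positive {k} {j} j< eq = <-irrefl (trans (sym (+-identityʳ j)) eq) j<

dist-rim-step : ∀ k t {j} → j < order k → Close (dist k t rim j) (dist k t rim (j + 1))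
dist-rim-step k t {j} j< with side k (<⇒≤ j<)
... | on-far {zero} eq _ = contradiction eq (far-positive {k} j<)
... | on-far {suc y} eq y≤ = close-subst
        (dist-far k t rim eq y≤)
        (dist-far k t rim (trans (+-assoc j 1 y) eq) (≤-trans (n≤1+n y) y≤))
        (close-sym (ray-rim-step t y))
... | on-near j≤ with j + 1 ≤? 1 + 3 * k
...   | yes j+1≤ = close-subst (dist-near k t rim j≤)
          (trans (dist-near k t rim j+1≤) (cong (ray t rim) (+-comm j 1))) (ray-rim-step t j)
-- The antipodal edge: `j` is `1 + 3 * k`, and `j + 1` has the same arc on the other side.
...   | no ¬j+1≤ = close-refl (trans (dist-near k t rim j≤) (sym (dist-far k t rim antipode j≤)))
  where
  j≡half : j ≡ 1 + 3 * k
  j≡half = ≤-antisym j≤ (≤-pred (≤-trans (≰⇒> ¬j+1≤) (≤-reflexive (+-comm j 1))))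
  regroup : ∀ h → 1 + h + 1 + (1 + h) ≡ 1 + h + (2 + h)
  regroup = solve-∀
  antipode : j + 1 + j ≡ order k
  antipode = trans (cong (λ i → i + 1 + i) j≡half) (trans (regroup (3 * k)) (order-halves k))

-- For inner edges straddling the antipode of P(n,3) with n = `order (suc k)`: the arcs of the ends
-- are `3 * k + 2` and `3 * k + 4` in some order, or both `3 * k + 3`.
ray-hub-turn : ∀ t → ray t hub 2 ≡ ray t hub 4
ray-hub-turn rim = refl
ray-hub-turn hub = refl

ray-hub-1-2 : ∀ t → Close (ray t hub 1) (ray t hub 2)
ray-hub-1-2 rim = close-suc refl
ray-hub-1-2 hub = close-suc refl

dist-hub-step : ∀ k t {j} → j < order (suc k) → Close (dist (suc k) t hub j) (dist (suc k) t hub (j + 3))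
dist-hub-step k t {j} j< with side (suc k) (<⇒≤ j<)
... | on-far {zero} eq _ = contradiction eq (far-positive {suc k} j<)
-- From one index before the landmark, an inner edge jumps past it to two indices after; the next
-- clause is the mirror case.
... | on-far {1} eq y≤ = close-subst (dist-far (suc k) t hub eq y≤)
        (trans (dist-mod (suc k) t hub {j + 3} {2 + order (suc k)} (cong (_% order (suc k)) wrap))
          (trans (dist-period (suc k) t hub 2) (dist-near (suc k) t hub (≤-trans (m≤m+n 2 2) (half-mono k (s≤s z≤n))))))
        (ray-hub-1-2 t)
  where
  wrap : j + 3 ≡ 2 + order (suc k)
  wrap = trans (sym (+-assoc j 1 2)) (trans (+-comm (j + 1) 2) (cong (2 +_) eq))
... | on-far {2} eq y≤ = close-subst (dist-far (suc k) t hub eq y≤)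
        (trans (dist-mod (suc k) t hub {j + 3} {1 + order (suc k)} (cong (_% order (suc k)) wrap))
          (trans (dist-period (suc k) t hub 1) (dist-near (suc k) t hub (s≤s z≤n))))
        (close-sym (ray-hub-1-2 t))
  where
  wrap : j + 3 ≡ 1 + order (suc k)
  wrap = trans (sym (+-assoc j 2 1)) (trans (+-comm (j + 2) 1) (cong (1 +_) eq))
... | on-far {suc (suc (suc y))} eq y≤ = close-subst
        (dist-far (suc k) t hub eq y≤)
        (dist-far (suc k) t hub (trans (+-assoc j 3 y) eq) (≤-trans (m≤n+m y 3) y≤))
        (close-sym (close-suc (ray-hub-shift t y)))
... | on-near j≤ with j + 3 ≤? 1 + 3 * suc k
...   | yes j+3≤ = close-subst (dist-near (suc k) t hub j≤)
          (trans (dist-near (suc k) t hub j+3≤) (cong (ray t hub) (+-comm j 3))) (close-suc (ray-hub-shift t j))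
...   | no ¬j+3≤ with m≤n⇒∃[o]m+o≡n 2+3k≤j
  where
  2+3k≤j : 3 * k + 2 ≤ j
  2+3k≤j = +-cancelʳ-≤ 3 (3 * k + 2) j (≤-trans (≤-reflexive (regroup k)) (≰⇒> ¬j+3≤))
    where
    regroup : ∀ k → 3 * k + 2 + 3 ≡ 2 + 3 * suc k
    regroup = solve-∀
...     | i , refl = turn i (+-cancelˡ-≤ (3 * k + 2) i 2 (≤-trans j≤ (≤-reflexive (regroup k)))) j≤
  where
  regroup : ∀ k → 1 + 3 * suc k ≡ 3 * k + 2 + 2
  regroup = solve-∀
  across : ∀ k i y → i + y ≡ 4 → 3 * k + 2 + i + 3 + (3 * k + y) ≡ order (suc k)
  across k i y eq = trans (rearrange k i y) (trans (cong (λ s → 3 * k + 3 * k + 5 + s) eq) (total k))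
    where
    rearrange : ∀ k i y → 3 * k + 2 + i + 3 + (3 * k + y) ≡ 3 * k + 3 * k + 5 + (i + y)
    rearrange = solve-∀
    total : ∀ k → 3 * k + 3 * k + 5 + 4 ≡ 3 + 6 * suc k
    total = solve-∀
  low : ∀ {y} → y ≤ 4 → 3 * k + y ≤ 1 + 3 * suc k
  low {y} y≤ = ≤-trans (+-monoʳ-≤ (3 * k) y≤) (≤-reflexive (total k))
    where
    total : ∀ k → 3 * k + 4 ≡ 1 + 3 * suc k
    total = solve-∀
  both : ∀ i y → i + y ≡ 4 → 3 * k + 2 + i ≤ 1 + 3 * suc k → y ≤ 4 → ray t hub (2 + i) ≡ ray t hub y →
    Close (dist (suc k) t hub (3 * k + 2 + i)) (dist (suc k) t hub (3 * k + 2 + i + 3))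
  both i y eq i≤ y≤ same = close-refl (begin
    dist (suc k) t hub (3 * k + 2 + i)     ≡⟨ dist-near (suc k) t hub i≤ ⟩
    ray t hub (3 * k + 2 + i)              ≡⟨ cong (ray t hub) (+-assoc (3 * k) 2 i) ⟩
    ray t hub (3 * k + (2 + i))            ≡⟨ ray-hub-far t k (2 + i) ⟩
    k + ray t hub (2 + i)                  ≡⟨ cong (k +_) same ⟩
    k + ray t hub y                        ≡⟨ ray-hub-far t k y ⟨
    ray t hub (3 * k + y)                  ≡⟨ dist-far (suc k) t hub {3 * k + 2 + i + 3} (across k i y eq) (low y≤) ⟨
    dist (suc k) t hub (3 * k + 2 + i + 3) ∎)
    where open ≡-Reasoning
  turn : ∀ i → i ≤ 2 → 3 * k + 2 + i ≤ 1 + 3 * suc k →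
    Close (dist (suc k) t hub (3 * k + 2 + i)) (dist (suc k) t hub (3 * k + 2 + i + 3))
  turn 0 _ i≤ = both 0 4 refl i≤ ≤-refl (ray-hub-turn t)
  turn 1 _ i≤ = both 1 3 refl i≤ (n≤1+n 3) refl
  turn 2 _ i≤ = both 2 2 refl i≤ (m≤m+n 2 2) (sym (ray-hub-turn t))
  turn (suc (suc (suc _))) (s≤s (s≤s ())) _

-- The closed form is the graph distance.

vertex : ∀ {n} → Layer → Fin n → PVertex n
vertex rim = inj₁
vertex hub = inj₂

layer : ∀ {n} → PVertex n → Layer
layer (inj₁ _) = rim
layer (inj₂ _) = hub

index : ∀ {n} → PVertex n → Fin n
index (inj₁ i) = i
index (inj₂ i) = i

layer-vertex : ∀ {n} a (i : Fin n) → layer (vertex a i) ≡ a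
layer-vertex rim i = refl
layer-vertex hub i = refl

index-vertex : ∀ {n} a (i : Fin n) → index (vertex a i) ≡ i
index-vertex rim i = refl
index-vertex hub i = refl

vertex-η : ∀ {n} (x : PVertex n) → vertex (layer x) (index x) ≡ x
vertex-η (inj₁ _) = refl
vertex-η (inj₂ _) = refl

residue : ∀ {n} .{{_ : NonZero n}} → Fin n → Fin n → ℕ
residue {n} p i = (toℕ i + (n ∸ toℕ p)) % n

module _ {n : ℕ} .{{_ : NonZero n}} (p : Fin n) where

  residue-self : residue p p ≡ 0
  residue-self = trans (cong (_% n) (m+[n∸m]≡n (<⇒≤ (toℕ<n p)))) (n%n≡0 n)

  residue-⊕ : ∀ i s → residue p (i ⊕ s) ≡ (residue p i + s) % n
  residue-⊕ i s = begin
    (toℕ (i ⊕ s) + c) % n       ≡⟨ cong (λ r → (r + c) % n) (toℕ-⊕ i s) ⟩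
    ((toℕ i + s) % n + c) % n   ≡⟨ %-absorbˡ (toℕ i + s) c ⟩
    (toℕ i + s + c) % n         ≡⟨ cong (_% n) (swap (toℕ i) s c) ⟩
    (toℕ i + c + s) % n         ≡⟨ %-absorbˡ (toℕ i + c) s ⟨
    ((toℕ i + c) % n + s) % n   ∎
    where
    open ≡-Reasoning
    c = n ∸ toℕ p
    swap : ∀ x s c → x + s + c ≡ x + c + s
    swap = solve-∀

  residue-zero : ∀ i → residue p i ≡ 0 → i ≡ p
  residue-zero i eq = toℕ-injective (begin
    toℕ i                       ≡⟨ m<n⇒m%n≡m (toℕ<n i) ⟨
    toℕ i % n                   ≡⟨ [m+n]%n≡m%n (toℕ i) n ⟨
    (toℕ i + n) % n             ≡⟨ cong (λ s → (toℕ i + s) % n) (m∸n+n≡m (<⇒≤ (toℕ<n p))) ⟨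
    (toℕ i + (c + toℕ p)) % n   ≡⟨ cong (_% n) (+-assoc (toℕ i) c (toℕ p)) ⟨
    (toℕ i + c + toℕ p) % n     ≡⟨ %-absorbˡ (toℕ i + c) (toℕ p) ⟨
    (residue p i + toℕ p) % n   ≡⟨ cong (λ r → (r + toℕ p) % n) eq ⟩
    toℕ p % n                   ≡⟨ m<n⇒m%n≡m (toℕ<n p) ⟩
    toℕ p                       ∎)
    where
    open ≡-Reasoning
    c = n ∸ toℕ p

module _ (k₀ : ℕ) (t : Layer) (p : Fin (order (suc k₀))) where

  private
    k = suc k₀
    n = order k

  distTo : PVertex n → ℕ
  distTo x = dist k t (layer x) (residue p (index x))

  dist-⊕ : ∀ a i s → dist k t a (residue p (i ⊕ s)) ≡ dist k t a (residue p i + s)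
  dist-⊕ a i s = dist-mod k t a {residue p (i ⊕ s)} {residue p i + s}
    (trans (cong (_% n) (residue-⊕ p i s)) (m%n%n≡m%n (residue p i + s) n))

  residue< : ∀ i → residue p i < n
  residue< i = m%n<n (toℕ i + (n ∸ toℕ p)) n

  adjacent-close : ∀ {x y} → PAdj n x y → Close (distTo x) (distTo y)
  adjacent-close (outer i)  = close-subst refl (dist-⊕ rim i 1) (dist-rim-step k t (residue< i))
  adjacent-close (outer' i) = close-sym (adjacent-close (outer i))
  adjacent-close (spoke i)  = dist-spoke k t (residue p i)
  adjacent-close (spoke' i) = close-sym (adjacent-close (spoke i))
  adjacent-close (inner i)  = close-subst refl (dist-⊕ hub i 3) (dist-hub-step k₀ t (residue< i))
  adjacent-close (inner' i) = close-sym (adjacent-close (inner i))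

  distTo-vertex : ∀ a i → distTo (vertex a i) ≡ dist k t a (residue p i)
  distTo-vertex rim i = refl
  distTo-vertex hub i = refl

  distTo-source : distTo (vertex t p) ≡ 0
  distTo-source = trans (distTo-vertex t p)
    (trans (cong (dist k t t) (residue-self p)) (trans (dist-near k t t z≤n) (ray-source t)))

  -- The lower bound: `distTo` is 0 at the landmark and changes by at most 1 along an edge.
  walk-long : ∀ {x ℓ} → Walk (PAdj n) x (vertex t p) ℓ → distTo x ≤ ℓ
  walk-long here = ≤-reflexive distTo-source
  walk-long (step e w) = ≤-trans (proj₁ (adjacent-close e)) (s≤s (walk-long w))

  distTo-zero : ∀ x → distTo x ≡ 0 → x ≡ vertex t p
  distTo-zero x eq with side k (<⇒≤ (residue< (index x)))
  ... | on-near r≤ with ray-zero t (layer x) _ (trans (sym (dist-near k t (layer x) r≤)) eq)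
  ...   | t≡ , r≡ = trans (sym (vertex-η x)) (cong₂ vertex (sym t≡) (residue-zero p (index x) r≡))
  distTo-zero x eq | on-far y≡ y≤ with ray-zero t (layer x) _ (trans (sym (dist-far k t (layer x) y≡ y≤)) eq)
  ...   | _ , refl = contradiction y≡ (far-positive {k} (residue< (index x)))

  Closer : PVertex n → ℕ → Set
  Closer x d = ∃ λ y → PAdj n x y × distTo y ≡ d

  across : ∀ a i {d} → dist k t (flip a) (residue p i) ≡ d → Closer (vertex a i) d
  across rim i eq = inj₂ i , spoke i , eq
  across hub i eq = inj₁ i , spoke' i , eq

  rim-forward : ∀ i {d} → dist k t rim (residue p i + 1) ≡ d → Closer (inj₁ i) d
  rim-forward i eq = inj₁ (i ⊕ 1) , outer i , trans (dist-⊕ rim i 1) eq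

  -- Edges are stated with `⊕` alone, so one index back is `n ∸ 1` forward, and the edge used is the
  -- reversed one based there.
  rim-backward : ∀ i {d} → dist k t rim (residue p i + (n ∸ 1)) ≡ d → Closer (inj₁ i) d
  rim-backward i eq = inj₁ (i ⊕ (n ∸ 1)) ,
    subst (λ j → PAdj n (inj₁ j) (inj₁ (i ⊕ (n ∸ 1)))) (⊕-back i (s≤s z≤n)) (outer' (i ⊕ (n ∸ 1))) ,
    trans (dist-⊕ rim i (n ∸ 1)) eq

  hub-forward : ∀ i {d} → dist k t hub (residue p i + 3) ≡ d → Closer (inj₂ i) d
  hub-forward i eq = inj₂ (i ⊕ 3) , inner i , trans (dist-⊕ hub i 3) eq

  hub-backward : ∀ i {d} → dist k t hub (residue p i + (n ∸ 3)) ≡ d → Closer (inj₂ i) d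
  hub-backward i eq = inj₂ (i ⊕ (n ∸ 3)) ,
    subst (λ j → PAdj n (inj₂ j) (inj₂ (i ⊕ (n ∸ 3)))) (⊕-back i (s≤s (s≤s (s≤s z≤n)))) (inner' (i ⊕ (n ∸ 3))) ,
    trans (dist-⊕ hub i (n ∸ 3)) eq

  dist-backward : ∀ a s {r y} → s ≤ n → r ≡ s + y → y ≤ 1 + 3 * k → dist k t a (r + (n ∸ s)) ≡ ray t a y
  dist-backward a s {r} {y} s≤n refl y≤ = begin
    dist k t a (s + y + (n ∸ s)) ≡⟨ cong (λ j → dist k t a (j + (n ∸ s))) (+-comm s y) ⟩
    dist k t a (y + s + (n ∸ s)) ≡⟨ cong (dist k t a) (+-assoc y s (n ∸ s)) ⟩
    dist k t a (y + (s + (n ∸ s))) ≡⟨ cong (λ j → dist k t a (y + j)) (m+[n∸m]≡n s≤n) ⟩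
    dist k t a (y + n)           ≡⟨ dist-period k t a y ⟩
    dist k t a y                 ≡⟨ dist-near k t a y≤ ⟩
    ray t a y                    ∎
    where open ≡-Reasoning

  -- On this side a smaller index in `Descent` means a step backward around the cycle, in
  -- `closer-far` a step forward. As the index never grows, the bound on the arc persists.
  closer-near : ∀ a i {r d} → residue p i ≡ r → r ≤ 1 + 3 * k → Descent t a r d → Closer (vertex a i) d
  closer-near a i {r} eq r≤ (cross v) = across a i (trans (cong (dist k t (flip a)) eq) (trans (dist-near k t (flip a) r≤) v))
  closer-near rim i eq r≤ (along-rim {x = x} v) =
    rim-backward i (trans (dist-backward rim 1 (s≤s z≤n) eq (≤-trans (n≤1+n x) r≤)) v)
  closer-near hub i eq r≤ (along-hub {x = x} v) =
    hub-backward i (trans (dist-backward hub 3 (s≤s (s≤s (s≤s z≤n))) eq (≤-trans (m≤n+m x 3) r≤)) v)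

  closer-far : ∀ a i {y d} → residue p i + y ≡ n → y ≤ 1 + 3 * k → Descent t a y d → Closer (vertex a i) d
  closer-far a i eq y≤ (cross v) = across a i (trans (dist-far k t (flip a) eq y≤) v)
  closer-far rim i eq y≤ (along-rim {x = x} v) = rim-forward i
    (trans (dist-far k t rim (trans (+-assoc (residue p i) 1 x) eq) (≤-trans (n≤1+n x) y≤)) v)
  closer-far hub i eq y≤ (along-hub {x = x} v) = hub-forward i
    (trans (dist-far k t hub (trans (+-assoc (residue p i) 3 x) eq) (≤-trans (m≤n+m x 3) y≤)) v)

  closer : ∀ x {d} → distTo x ≡ suc d → Closer x d
  closer x eq with side k (<⇒≤ (residue< (index x)))
  ... | on-near r≤ = subst (λ v → Closer v _) (vertex-η x)
          (closer-near (layer x) (index x) refl r≤ (descent t (layer x) _ (trans (sym (dist-near k t (layer x) r≤)) eq)))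
  ... | on-far y≡ y≤ = subst (λ v → Closer v _) (vertex-η x)
          (closer-far (layer x) (index x) y≡ y≤ (descent t (layer x) _ (trans (sym (dist-far k t (layer x) y≡ y≤)) eq)))

  -- The upper bound, by greedy descent.
  walk-short : ∀ d x → distTo x ≡ d → Walk (PAdj n) x (vertex t p) d
  walk-short zero x eq = subst (λ v → Walk (PAdj n) x v 0) (distTo-zero x eq) here
  walk-short (suc d) x eq with closer x eq
  ... | y , e , eq′ = step e (walk-short d y eq′)

  isDist⇒distTo : ∀ {x d} → IsDist (PAdj n) x (vertex t p) d → d ≡ distTo x
  isDist⇒distTo {x} (w , least) = ≤-antisym (least _ (walk-short _ x refl)) (walk-long w)

-- No three landmarks resolve.

pad : ∀ {A : Set} → A → (xs : List A) → length xs ≤ 3 → ∃ λ x → ∃ λ y → ∃ λ z → xs ⊆ x ∷ y ∷ z ∷ []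
-- The default fills the empty list; shorter nonempty lists repeat a member. Extra landmarks only
-- make agreement harder, so treating exactly three is enough.
pad a []              _ = a , a , a , λ ()
pad a (x ∷ [])         _ = x , x , x , λ { (Any.here q) → Any.here q }
pad a (x ∷ y ∷ [])     _ = x , y , y , λ { (Any.here q) → Any.here q ; (Any.there (Any.here q)) → Any.there (Any.here q) }
pad a (x ∷ y ∷ z ∷ []) _ = x , y , z , λ q → q
pad a (_ ∷ _ ∷ _ ∷ _ ∷ _) (s≤s (s≤s (s≤s ())))

not-resolving : ∀ e (W : List (PVertex (order (6 + e)))) → length W ≤ 3 → ¬ Resolving (PAdj (order (6 + e))) W
not-resolving e W |W|≤3 resolving with pad (inj₁ zero) W |W|≤3
... | w₁ , w₂ , w₃ , W⊆
  with blind-pair e (layer w₁) (layer w₂) (layer w₃)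
         -- `index w₁ ⊕ (35 + 6 * e)`, four indices before the first landmark, starts the near
         -- window; its residues from the other landmarks are their offsets.
         (residue< (5 + e) rim (index w₂) (index w₁ ⊕ (35 + 6 * e)))
         (residue< (5 + e) rim (index w₃) (index w₁ ⊕ (35 + 6 * e)))
... | (w , (a , m) , (a' , m')) , (m≤ , m'≤ , distinct) , b₁ , b₂ , b₃ =
  distinct (cong₂ _,_
    (trans (sym (layer-vertex a _)) (trans (cong layer same) (layer-vertex a' _)))
    -- Indices up to 10 are below the order, so distinct spots of a window are distinct vertices.
    (⊕-cancelˡ base (fits m≤) (fits m'≤)
      (trans (sym (index-vertex a _)) (trans (cong index same) (index-vertex a' _)))))
  where
  k = 6 + e
  n = order k
  left base : Fin n
  left = index w₁ ⊕ (35 + 6 * e)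
  base = left ⊕ start w k
  fits : ∀ {m} → m ≤ 10 → m < n
  fits m≤ = ≤-trans (s≤s m≤) (≤-trans (m≤m+n 11 28) (+-monoʳ-≤ 3 (*-monoʳ-≤ 6 (m≤m+n 6 e))))
  z = vertex a (base ⊕ m)
  z' = vertex a' (base ⊕ m')
  at : ∀ t p a m → distTo (5 + e) t p (vertex a (base ⊕ m)) ≡ dist k t a (start w k + residue p left + m)
  at t p a m = begin
    distTo (5 + e) t p (vertex a (base ⊕ m))      ≡⟨ distTo-vertex (5 + e) t p a (base ⊕ m) ⟩
    dist k t a (residue p (base ⊕ m))             ≡⟨ cong (λ i → dist k t a (residue p i)) (⊕-assoc left (start w k) m) ⟩
    dist k t a (residue p (left ⊕ (start w k + m))) ≡⟨ dist-⊕ (5 + e) t p a left (start w k + m) ⟩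
    dist k t a (residue p left + (start w k + m)) ≡⟨ cong (dist k t a) (swap (residue p left) (start w k) m) ⟩
    dist k t a (start w k + residue p left + m)   ∎
    where
    open ≡-Reasoning
    swap : ∀ r s m → r + (s + m) ≡ s + r + m
    swap = solve-∀
  residue₁ : residue (index w₁) left ≡ 35 + 6 * e
  residue₁ = trans (residue-⊕ (index w₁) (index w₁) (35 + 6 * e))
    (trans (cong (λ r → (r + (35 + 6 * e)) % n) (residue-self (index w₁)))
      (m<n⇒m%n≡m (≤-trans (m<m+n (35 + 6 * e) (s≤s z≤n)) (≤-reflexive (before-end e)))))
    where
    before-end : ∀ e → 35 + 6 * e + 4 ≡ 3 + 6 * (6 + e)
    before-end = solve-∀
  Agree : PVertex n → Set
  Agree v = distTo (5 + e) (layer v) (index v) z ≡ distTo (5 + e) (layer v) (index v) z'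
  agree : ∀ v → Blind k (w , (a , m) , (a' , m')) (layer v) (residue (index v) left) → Agree v
  agree v b = trans (at (layer v) (index v) a m) (trans b (sym (at (layer v) (index v) a' m')))
  all-agree : All Agree (w₁ ∷ w₂ ∷ w₃ ∷ [])
  all-agree = agree w₁ (subst (Blind k (w , (a , m) , (a' , m')) (layer w₁)) (sym residue₁) b₁) ∷ agree w₂ b₂ ∷ agree w₃ b₃ ∷ []
  same : z ≡ z'
  same = resolving z z' λ v v∈W d d' isd isd' →
    trans (isDist⇒distTo (5 + e) (layer v) (index v) (subst (λ u → IsDist (PAdj n) z u d) (sym (vertex-η v)) isd))
      (trans (All.lookup all-agree (W⊆ v∈W))
        (sym (isDist⇒distTo (5 + e) (layer v) (index v) (subst (λ u → IsDist (PAdj n) z' u d') (sym (vertex-η v)) isd'))))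

theorem1 : (k : ℕ) → 6 ≤ k →
    (W : List (PVertex (3 + 6 * k))) → Unique W →
    Resolving (PAdj (3 + 6 * k)) W → 4 ≤ length W
theorem1 k 6≤k W _ resolving with 4 ≤? length W | m≤n⇒∃[o]m+o≡n 6≤k
... | yes 4≤ | _ = 4≤
... | no ¬4≤ | e , refl = contradiction resolving (not-resolving e W (≤-pred (≰⇒> ¬4≤)))
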